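{- Let $G$ be a finite simple graph and $c_0:V(G)\to\mathbb{Z}$ an initial configuration, with $(c_t)_{t\ge0}$ the configurations of the diffusion process. Then $G$ with $c_0$ is tight if and only if there exists $t\geq 0$ such that $c_t$ has property plus.
   Context: Diffusion process: for a configuration $c_t:V(G)\to\mathbb{Z}$ and a vertex $u$, let $\Delta_t^-(u)=|\{w\in N(u): c_t(u)>c_t(w)\}|$, $\Delta_t^+(u)=|\{w\in N(u): c_t(u)<c_t(w)\}|$ and $\Delta_t(u)=\Delta_t^+(u)-\Delta_t^-(u)$. Then $c_{t+1}(u)=c_t(u)+\Delta_t(u)$ for all $u$ simultaneously. The pair $(G,c_0)$ is called tight if the process is eventually fixed or eventually periodic with period length $2$, i.e. there exists $t\geq0$ with $c_{t+2}=c_t$. A configuration $c_i$ has property plus if (1) $c_i(u)+\Delta_i(u)>c_i(v)+\Delta_i(v)$ for every edge $uv$ with $c_i(u)<c_i(v)$, and (2) $c_i(u)+\Delta_i(u)=c_i(v)+\Delta_i(v)$ for every edge $uv$ with $c_i(u)=c_i(v)$. -}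

module Defs where

open import Data.Fin.Base using (Fin)
open import Data.Integer.Base using (ℤ; +_; _+_; _-_; _<_; _>_)
open import Data.Integer.Properties using (_<?_)
open import Data.List.Base using (List; allFin; filter; length)
open import Data.Nat.Base using (ℕ; zero; suc)
open import Data.Product.Base using (∃-syntax; _×_)
open import Level using (0ℓ)
open import Relation.Binary.Core using (Rel)
open import Relation.Binary.Definitions using (Decidable; Irreflexive; Symmetric)
open import Relation.Binary.PropositionalEquality using (_≡_; _≗_)

record SimpleGraph (n : ℕ) : Set₁ where
  field
    Adj     : Rel (Fin n) 0ℓ
    adj?    : Decidable Adj
    symm    : Symmetric Adj
    irrefl  : Irreflexive _≡_ Adj

  -- The neighbourhood N(u); allFin n has no repetitions, so the length of a
  -- filtered neighbourhood is the cardinality of the corresponding subset.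
  neighbours : Fin n → List (Fin n)
  neighbours u = filter (adj? u) (allFin n)

Configuration : ℕ → Set
Configuration n = Fin n → ℤ

module Diffusion {n : ℕ} (G : SimpleGraph n) where
  open SimpleGraph G

  Δ⁻ : Configuration n → Fin n → ℕ
  Δ⁻ c u = length (filter (λ w → c w <? c u) (neighbours u))

  Δ⁺ : Configuration n → Fin n → ℕ
  Δ⁺ c u = length (filter (λ w → c u <? c w) (neighbours u))

  Δ : Configuration n → Fin n → ℤ
  Δ c u = + Δ⁺ c u - + Δ⁻ c u

  step : Configuration n → Configuration n
  step c u = c u + Δ c u

  process : Configuration n → ℕ → Configuration n
  process c₀ zero    = c₀
  process c₀ (suc t) = step (process c₀ t)

  -- Eventually fixed or eventually periodic with period length 2.
  Tight : Configuration n → Set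
  Tight c₀ = ∃[ t ] process c₀ (suc (suc t)) ≗ process c₀ t

  PropertyPlus : Configuration n → Set
  PropertyPlus c =
    (∀ u v → Adj u v → c u < c v → c u + Δ c u > c v + Δ c v) ×
    (∀ u v → Adj u v → c u ≡ c v → c u + Δ c u ≡ c v + Δ c v)

{-# OPTIONS --safe #-}

-- For an antisymmetric flow f on pairs of vertices whose row sums vanish,
-- ∑ᵤ∑ᵥ f(u,v)(x(v) − x(u)) = 0 for every x.  Let y be the successor of x.  If the
-- successor of y is x again, then Δx + Δy = 0, so this applies to
-- f(u,v) = sgn(x(v) − x(u)) + sgn(y(v) − y(u)) on the edges.  Every term of the
-- sum is then nonnegative, hence zero, so the sign of y on an edge is opposite to
-- a nonzero sign of x.  Exchanging x and y shows that edges level for x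
-- are level for y.  Conversely, property plus reverses all signs, so the next
-- step undoes the current one.
module Submission where

open import Defs
open import Data.Bool.Base using (if_then_else_)
open import Data.Fin.Base using (Fin; zero; suc)
open import Data.Integer.Base hiding (suc)
open import Data.Integer.Properties
open import Data.Integer.Tactic.RingSolver using (solve-∀)
open import Data.List.Base using (filter; length; tabulate)
open import Data.Nat.Base using (ℕ; zero; suc; z≤n)
open import Data.Product.Base using (∃-syntax; _,_)
open import Data.Sum.Base using (inj₁; inj₂)
open import Function.Base using (id; _∘_)
open import Function.Bundles using (_⇔_; mk⇔)
open import Level using (Level)
open import Relation.Binary.Definitions using (tri<; tri≈; tri>)
open import Relation.Binary.PropositionalEquality
open import Relation.Nullary.Decidable.Core using (Dec; does; yes; no)
open import Relation.Nullary.Decidable using (dec-true; dec-false)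
open import Relation.Nullary.Negation using (¬_; contradiction)
open import Relation.Unary using (Pred; Decidable)

open import Algebra.Bundles using (CommutativeRing)
open import Algebra.Properties.Semiring.Sum
  (CommutativeRing.semiring +-*-commutativeRing)

open ≡-Reasoning

private variable
  a p q : Level
  A B : Set a
  i j : ℤ

-- Indicators and counting.

⟦_⟧ : Dec A → ℤ
⟦ a? ⟧ = if does a? then 1ℤ else 0ℤ

⟦⟧-true : (a? : Dec A) → A → ⟦ a? ⟧ ≡ 1ℤ
⟦⟧-true a? x = cong (if_then 1ℤ else 0ℤ) (dec-true a? x)

⟦⟧-false : (a? : Dec A) → ¬ A → ⟦ a? ⟧ ≡ 0ℤ
⟦⟧-false a? ¬x = cong (if_then 1ℤ else 0ℤ) (dec-false a? ¬x)

⟦⟧-cong : (a? : Dec A) (b? : Dec B) → (A → B) → (B → A) → ⟦ a? ⟧ ≡ ⟦ b? ⟧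
⟦⟧-cong (yes x) b? f g = sym (⟦⟧-true b? (f x))
⟦⟧-cong (no ¬x) b? f g = sym (⟦⟧-false b? (¬x ∘ g))

-- Turns the cardinalities in `Δ⁺` and `Δ⁻` into sums over all vertices, where algebra applies. A
-- general `f` lets the induction pass to `f ∘ suc`; the vertex list is the case `id`.
length-filter²-tabulate :
  {P : Pred A p} {Q : Pred A q} (P? : Decidable P) (Q? : Decidable Q) →
  ∀ {m} (f : Fin m → A) →
  + length (filter P? (filter Q? (tabulate f))) ≡ ∑[ r < m ] (⟦ Q? (f r) ⟧ * ⟦ P? (f r) ⟧)
length-filter²-tabulate P? Q? {zero}  f = refl
length-filter²-tabulate P? Q? {suc m} f with Q? (f zero)
... | no  _ = trans (length-filter²-tabulate P? Q? (f ∘ suc)) (sym (+-identityˡ _))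
... | yes _ with P? (f zero)
...   | yes _ = cong (_+_ 1ℤ) (length-filter²-tabulate P? Q? (f ∘ suc))
...   | no  _ = trans (length-filter²-tabulate P? Q? (f ∘ suc)) (sym (+-identityˡ _))

-- Signs of differences.

-- The sign of j − i.
slope : ℤ → ℤ → ℤ
slope i j = ⟦ i <? j ⟧ - ⟦ j <? i ⟧

slope-antisym : ∀ i j → slope j i ≡ - slope i j
slope-antisym i j = lemma ⟦ i <? j ⟧ ⟦ j <? i ⟧
  where
  lemma : ∀ s t → t - s ≡ - (s - t)
  lemma = solve-∀

slope-< : i < j → slope i j ≡ 1ℤ
slope-< {i} {j} i<j =
  cong₂ _-_ (⟦⟧-true (i <? j) i<j) (⟦⟧-false (j <? i) (<-asym i<j))

slope-> : i > j → slope i j ≡ -1ℤ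
slope-> {i} {j} i>j = trans (slope-antisym j i) (cong -_ (slope-< i>j))

slope-≡ : i ≡ j → slope i j ≡ 0ℤ
-- Both brackets are now the same term, so they cancel without being evaluated.
slope-≡ {i} refl = i≡j⇒i-j≡0 {⟦ i <? i ⟧} refl

slope≡-1⇒> : slope i j ≡ -1ℤ → i > j
slope≡-1⇒> {i} {j} eq with <-cmp i j
... | tri< i<j _ _ = contradiction (trans (sym (slope-< i<j)) eq) λ ()
... | tri≈ _ i≡j _ = contradiction (trans (sym (slope-≡ i≡j)) eq) λ ()
... | tri> _ _ i>j = i>j

0≤1+slope : ∀ i j → 0ℤ ≤ 1ℤ + slope i j
0≤1+slope i j with <-cmp i j
... | tri< i<j _ _ rewrite slope-< i<j = +≤+ z≤n
... | tri≈ _ i≡j _ rewrite slope-≡ i≡j = +≤+ z≤n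
... | tri> _ _ i>j rewrite slope-> i>j = +≤+ z≤n

*-nonNeg : 0ℤ ≤ i → 0ℤ ≤ j → 0ℤ ≤ i * j
*-nonNeg {i} {j} 0≤i 0≤j = subst (_≤ i * j) (*-zeroʳ i)
  (*-monoˡ-≤-nonNeg i {{nonNegative 0≤i}} 0≤j)

-- When `i < j`, the first sign is 1 and the second is at least -1, so neither can pull the sum
-- below zero and both factors are nonnegative.
slope-aligned : ∀ i j k l → 0ℤ ≤ (slope i j + slope k l) * (j - i)
slope-aligned i j k l with <-cmp i j
... | tri< i<j _ _ = *-nonNeg
  (subst (λ s → 0ℤ ≤ s + slope k l) (sym (slope-< i<j)) (0≤1+slope k l))
  (i≤j⇒0≤j-i (<⇒≤ i<j))
... | tri≈ _ refl _ = ≤-reflexive (sym (begin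
  (slope i j + slope k l) * (j - i) ≡⟨ cong ((slope i j + slope k l) *_) (i≡j⇒i-j≡0 {j} refl) ⟩
  (slope i j + slope k l) * 0ℤ      ≡⟨ *-zeroʳ (slope i j + slope k l) ⟩
  0ℤ                                ∎))
-- Swapping both pairs flips the sign of each factor and keeps the product, which reduces this case
-- to the first.
... | tri> _ _ i>j = subst (0ℤ ≤_) eq (*-nonNeg
  (subst (λ s → 0ℤ ≤ s + slope l k) (sym (slope-< i>j)) (0≤1+slope l k))
  (i≤j⇒0≤j-i (<⇒≤ i>j)))
  where
  lemma : ∀ s t i j → (- s + - t) * (i - j) ≡ (s + t) * (j - i)
  lemma = solve-∀
  eq : (slope j i + slope l k) * (i - j) ≡ (slope i j + slope k l) * (j - i)
  eq = trans (cong₂ (λ s t → (s + t) * (i - j)) (slope-antisym i j) (slope-antisym k l))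
             (lemma (slope i j) (slope k l) i j)

-- Finite sums of integers.

∑-zero : ∀ {m} {f : Fin m → ℤ} → (∀ r → f r ≡ 0ℤ) → ∑[ r < m ] f r ≡ 0ℤ
∑-zero {m} f≡0 = trans (sum-cong-≗ f≡0) (sum-replicate-zero m)

∑-nonNeg : ∀ {m} {f : Fin m → ℤ} → (∀ r → 0ℤ ≤ f r) → 0ℤ ≤ ∑[ r < m ] f r
∑-nonNeg {zero}  0≤f = ≤-refl
∑-nonNeg {suc m} 0≤f = +-mono-≤ (0≤f zero) (∑-nonNeg (0≤f ∘ suc))

∑-nonNeg≡0 : ∀ {m} {f : Fin m → ℤ} → (∀ r → 0ℤ ≤ f r) →
             ∑[ r < m ] f r ≡ 0ℤ → ∀ r → f r ≡ 0ℤ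
∑-nonNeg≡0 {suc m} {f} 0≤f ∑≡0 = λ { zero → head≡0 ; (suc r) → ∑-nonNeg≡0 (0≤f ∘ suc) tail≡0 r }
  where
  head≡0 : f zero ≡ 0ℤ
  head≡0 = ≤-antisym
    -- The tail is nonnegative, so the head is at most the whole sum, which is zero.
    (subst₂ _≤_ (+-identityʳ _) ∑≡0 (+-monoʳ-≤ (f zero) (∑-nonNeg (0≤f ∘ suc))))
    (0≤f zero)
  tail≡0 : sum (f ∘ suc) ≡ 0ℤ
  tail≡0 = trans (sym (trans (cong (_+ sum (f ∘ suc)) head≡0) (+-identityˡ _))) ∑≡0

-- Antisymmetry splits each term into a part weighted by `x v` and a part weighted by `x u`.
-- Exchanging the order of summation makes the two halves equal, and each is a combination of the
-- vanishing row sums.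
∑-antisym-zeroRows :
  ∀ {m} (f : Fin m → Fin m → ℤ) (x : Fin m → ℤ) →
  (∀ u v → f v u ≡ - f u v) → (∀ u → ∑[ v < m ] f u v ≡ 0ℤ) →
  ∑[ u < m ] ∑[ v < m ] (f u v * (x v - x u)) ≡ 0ℤ
∑-antisym-zeroRows {m} f x antisym rows = begin
  ∑[ u < m ] ∑[ v < m ] (f u v * (x v - x u))
    ≡⟨ sum-cong-≗ (λ u → sum-cong-≗ (split u)) ⟩
  ∑[ u < m ] ∑[ v < m ] (- x v * f v u + - x u * f u v)
    ≡⟨ sum-cong-≗ (λ u → ∑-distrib-+ (λ v → - x v * f v u) (λ v → - x u * f u v)) ⟩
  ∑[ u < m ] (∑[ v < m ] (- x v * f v u) + ∑[ v < m ] (- x u * f u v))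
    ≡⟨ ∑-distrib-+ (λ u → ∑[ v < m ] (- x v * f v u)) (λ u → ∑[ v < m ] (- x u * f u v)) ⟩
  ∑[ u < m ] ∑[ v < m ] (- x v * f v u) + ∑[ u < m ] ∑[ v < m ] (- x u * f u v)
    ≡⟨ cong (_+ ∑[ u < m ] ∑[ v < m ] (- x u * f u v)) (∑-comm (λ u v → - x v * f v u)) ⟩
  ∑[ u < m ] ∑[ v < m ] (- x u * f u v) + ∑[ u < m ] ∑[ v < m ] (- x u * f u v)
    ≡⟨ cong₂ _+_ weighted weighted ⟩
  0ℤ ∎
  where
  lemma : ∀ s i j → s * (j - i) ≡ - j * (- s) + - i * s
  lemma = solve-∀
  split : ∀ u v → f u v * (x v - x u) ≡ - x v * f v u + - x u * f u v
  split u v rewrite antisym u v = lemma (f u v) (x u) (x v)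
  weighted : ∑[ u < m ] ∑[ v < m ] (- x u * f u v) ≡ 0ℤ
  weighted = ∑-zero λ u → begin
    ∑[ v < m ] (- x u * f u v) ≡⟨ *-distribˡ-sum (- x u) (f u) ⟨
    - x u * ∑[ v < m ] f u v   ≡⟨ cong (- x u *_) (rows u) ⟩
    - x u * 0ℤ                 ≡⟨ *-zeroʳ (- x u) ⟩
    0ℤ                         ∎

-- Flows along the edges.

module _ {n : ℕ} (G : SimpleGraph n) where
  open SimpleGraph G
  open Diffusion G

  -- The net amount that `u` receives from `v` in one step from `x`.
  flow : Configuration n → Fin n → Fin n → ℤ
  flow x u v = ⟦ adj? u v ⟧ * slope (x u) (x v)

  flow-antisym : ∀ x u v → flow x v u ≡ - flow x u v
  flow-antisym x u v = begin
    ⟦ adj? v u ⟧ * slope (x v) (x u)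
      ≡⟨ cong₂ _*_ (⟦⟧-cong (adj? v u) (adj? u v) symm symm) (slope-antisym (x u) (x v)) ⟩
    ⟦ adj? u v ⟧ * - slope (x u) (x v)
      ≡⟨ neg-distribʳ-* ⟦ adj? u v ⟧ (slope (x u) (x v)) ⟨
    - flow x u v ∎

  Δ≡∑flow : ∀ x u → Δ x u ≡ ∑[ v < n ] flow x u v
  Δ≡∑flow x u = begin
    + Δ⁺ x u - + Δ⁻ x u
      ≡⟨ cong₂ _-_ (length-filter²-tabulate (λ v → x u <? x v) (adj? u) id)
                   (length-filter²-tabulate (λ v → x v <? x u) (adj? u) id) ⟩
    sum up - sum down
      -- Writing `up` as `flow` plus `down` lets the sum of `down` cancel as a whole.
      ≡⟨ cong (_- sum down) (sum-cong-≗ split) ⟩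
    ∑[ v < n ] (flow x u v + down v) - sum down
      ≡⟨ cong (_- sum down) (∑-distrib-+ (flow x u) down) ⟩
    sum (flow x u) + sum down - sum down
      ≡⟨ cancel (sum (flow x u)) (sum down) ⟩
    sum (flow x u) ∎
    where
    up down : Fin n → ℤ
    up   v = ⟦ adj? u v ⟧ * ⟦ x u <? x v ⟧
    down v = ⟦ adj? u v ⟧ * ⟦ x v <? x u ⟧
    lemma : ∀ a s t → a * s ≡ a * (s - t) + a * t
    lemma = solve-∀
    split : ∀ v → up v ≡ flow x u v + down v
    split v = lemma ⟦ adj? u v ⟧ ⟦ x u <? x v ⟧ ⟦ x v <? x u ⟧
    cancel : ∀ s t → s + t - t ≡ s
    cancel = solve-∀

  Δ+Δ≡∑flow+flow : ∀ x y u → Δ x u + Δ y u ≡ ∑[ v < n ] (flow x u v + flow y u v)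
  Δ+Δ≡∑flow+flow x y u = trans (cong₂ _+_ (Δ≡∑flow x u) (Δ≡∑flow y u))
                               (sym (∑-distrib-+ (flow x u) (flow y u)))

  -- The pivot between periodicity and property plus. It is stated for an arbitrary pair rather than
  -- for `x` and `step x`, so that the two roles can be exchanged.
  Opposite : Configuration n → Configuration n → Set
  Opposite x y = ∀ u → Δ x u + Δ y u ≡ 0ℤ

  opposite-sym : ∀ {x y} → Opposite x y → Opposite y x
  opposite-sym {x} {y} opp u = trans (+-comm (Δ y u) (Δ x u)) (opp u)

  opposite⇒reversed : ∀ {x y} → Opposite x y →
                      ∀ {u v} → Adj u v → x u < x v → y u > y v
  opposite⇒reversed {x} {y} opp {u} {v} uv xu<xv = slope≡-1⇒> (begin
    slope (y u) (y v)               ≡⟨ isolate (slope (y u) (y v)) ⟩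
    1ℤ + slope (y u) (y v) - 1ℤ     ≡⟨ cong (λ s → s + slope (y u) (y v) - 1ℤ) (slope-< xu<xv) ⟨
    slopes u v - 1ℤ                 ≡⟨ cong (_- 1ℤ) slopes≡0 ⟩
    -1ℤ                             ∎)
    where
    isolate : ∀ s → s ≡ 1ℤ + s - 1ℤ
    isolate = solve-∀

    slopes f term : Fin n → Fin n → ℤ
    slopes u v = slope (x u) (x v) + slope (y u) (y v)
    f u v      = flow x u v + flow y u v
    term u v   = f u v * (x v - x u)

    f-antisym : ∀ u v → f v u ≡ - f u v
    f-antisym u v = trans (cong₂ _+_ (flow-antisym x u v) (flow-antisym y u v))
                          (sym (neg-distrib-+ (flow x u v) (flow y u v)))

    factor : ∀ a s t d → (a * s + a * t) * d ≡ a * ((s + t) * d)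
    factor = solve-∀

    term≡ : ∀ u v → term u v ≡ ⟦ adj? u v ⟧ * (slopes u v * (x v - x u))
    term≡ u v = factor ⟦ adj? u v ⟧ (slope (x u) (x v)) (slope (y u) (y v)) (x v - x u)

    0≤⟦⟧ : (a? : Dec A) → 0ℤ ≤ ⟦ a? ⟧
    0≤⟦⟧ (yes _) = +≤+ z≤n
    0≤⟦⟧ (no _)  = ≤-refl

    0≤term : ∀ u v → 0ℤ ≤ term u v
    0≤term u v = subst (0ℤ ≤_) (sym (term≡ u v))
      (*-nonNeg (0≤⟦⟧ (adj? u v)) (slope-aligned (x u) (x v) (y u) (y v)))

    term≡0 : term u v ≡ 0ℤ
    -- The inner application shows that the sum over each row is zero, the outer one that each term
    -- in row `u` is zero.
    term≡0 = ∑-nonNeg≡0 (0≤term u)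
      (∑-nonNeg≡0 (∑-nonNeg ∘ 0≤term)
        (∑-antisym-zeroRows f x f-antisym λ u → trans (sym (Δ+Δ≡∑flow+flow x y u)) (opp u)) u) v

    product≡0 : slopes u v * (x v - x u) ≡ 0ℤ
    product≡0 = begin
      slopes u v * (x v - x u)                  ≡⟨ *-identityˡ _ ⟨
      1ℤ * (slopes u v * (x v - x u))           ≡⟨ cong (_* (slopes u v * (x v - x u))) (⟦⟧-true (adj? u v) uv) ⟨
      ⟦ adj? u v ⟧ * (slopes u v * (x v - x u)) ≡⟨ term≡ u v ⟨
      term u v                                  ≡⟨ term≡0 ⟩
      0ℤ                                        ∎

    slopes≡0 : slopes u v ≡ 0ℤ
    slopes≡0 with i*j≡0⇒i≡0∨j≡0 (slopes u v) product≡0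
    ... | inj₁ eq = eq
    ... | inj₂ eq = contradiction (sym (i-j≡0⇒i≡j (x v) (x u) eq)) (<⇒≢ xu<xv)

  -- A strict inequality in `y` along the edge would, with the roles exchanged, force a strict one
  -- in `x`.
  opposite⇒level : ∀ {x y} → Opposite x y →
                   ∀ {u v} → Adj u v → x u ≡ x v → y u ≡ y v
  opposite⇒level {x} {y} opp {u} {v} uv xu≡xv with <-cmp (y u) (y v)
  ... | tri≈ _ eq _ = eq
  ... | tri< yu<yv _ _ = contradiction (sym xu≡xv) (<⇒≢ (opposite⇒reversed (opposite-sym opp) uv yu<yv))
  ... | tri> _ _ yu>yv = contradiction xu≡xv (<⇒≢ (opposite⇒reversed (opposite-sym opp) (symm uv) yu>yv))

  -- Periodicity and property plus.

  period2⇒opposite : ∀ {x} → step (step x) ≗ x → Opposite x (step x)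
  period2⇒opposite {x} period u = begin
    Δ x u + Δ (step x) u             ≡⟨ isolate (x u) (Δ x u) (Δ (step x) u) ⟩
    x u + Δ x u + Δ (step x) u - x u ≡⟨ i≡j⇒i-j≡0 (period u) ⟩
    0ℤ                               ∎
    where
    isolate : ∀ i s t → s + t ≡ i + s + t - i
    isolate = solve-∀

  opposite⇒period2 : ∀ {x} → Opposite x (step x) → step (step x) ≗ x
  opposite⇒period2 {x} opp u = begin
    x u + Δ x u + Δ (step x) u   ≡⟨ +-assoc (x u) (Δ x u) (Δ (step x) u) ⟩
    x u + (Δ x u + Δ (step x) u) ≡⟨ cong (_+_ (x u)) (opp u) ⟩
    x u + 0ℤ                     ≡⟨ +-identityʳ (x u) ⟩
    x u                          ∎

  opposite⇒plus : ∀ {x} → Opposite x (step x) → PropertyPlus x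
  opposite⇒plus opp = (λ _ _ → opposite⇒reversed opp) , (λ _ _ → opposite⇒level opp)

  -- The two signs on each edge cancel, and non-edges contribute nothing, so the two increments at
  -- `u` sum to zero term by term.
  plus⇒opposite : ∀ {x} → PropertyPlus x → Opposite x (step x)
  plus⇒opposite {x} (reversed , level) u =
    trans (Δ+Δ≡∑flow+flow x (step x) u) (∑-zero flows≡0)
    where
    y = step x
    slopes≡0 : ∀ {v} → Adj u v → slope (x u) (x v) + slope (y u) (y v) ≡ 0ℤ
    slopes≡0 {v} uv with <-cmp (x u) (x v)
    ... | tri< lt _ _ = cong₂ _+_ (slope-< lt) (slope-> (reversed u v uv lt))
    ... | tri≈ _ eq _ = cong₂ _+_ (slope-≡ eq) (slope-≡ (level u v uv eq))
    -- Property plus speaks of increasing edges only, so the edge is read from `v` to `u`.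
    ... | tri> _ _ gt = cong₂ _+_ (slope-> gt) (slope-< (reversed v u (symm uv) gt))

    flows≡0 : ∀ v → flow x u v + flow y u v ≡ 0ℤ
    flows≡0 v with adj? u v
    ... | no  _  = refl
    ... | yes uv = trans
      (cong₂ _+_ (*-identityˡ (slope (x u) (x v))) (*-identityˡ (slope (y u) (y v))))
      (slopes≡0 uv)

theorem14 : ∀ (n : ℕ) (G : SimpleGraph n) (c₀ : Configuration n) →
    let open Diffusion G in
    Tight c₀ ⇔ (∃[ t ] PropertyPlus (process c₀ t))
-- The same time `t` serves in both directions.
theorem14 n G c₀ = mk⇔
  (λ (t , period) → t , opposite⇒plus G (period2⇒opposite G period))
  (λ (t , plus) → t , opposite⇒period2 G (plus⇒opposite G plus))
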